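{- Every matrix $B\in\mathcal{B}_{R_8}$ is reducible with respect to $R_8$, where $$R_8=\frac12\begin{bmatrix} J&O&O&Y \\ Y&J&O&O \\ O&Y&J&O \\ O&O&Y&J \end{bmatrix}$$ and $J$, $O$, $Y=2I-J$ are square matrices of order $2$.
   Context: $I$ is the identity matrix, $J$ the all-ones matrix and $O$ the zero matrix. An adjacency matrix is a symmetric $01$-matrix with zero diagonal. An orthogonal matrix is regular if each of its rows sums to $1$. The level of a rational matrix is the smallest positive integer $\ell$ such that $\ell$ times the matrix is integral. A matrix is decomposable if it can be written as a non-trivial block-diagonal matrix after some permutation of its rows and columns (rows and columns may be permuted independently), and indecomposable otherwise. For a regular orthogonal matrix $R$, $\mathcal{V}_R$ is the set of $01$-vectors $v$ such that $R^Tv$ is again a $01$-vector, and $\mathcal{B}_R$ is the set of adjacency matrices $B$ such that $R^TBR$ is again an adjacency matrix. Reducibility: let $R$ be an indecomposable regular orthogonal matrix of level $2$ and let $B\in\mathcal{B}_R$. Then $B$ is reducible with respect to $R$ if there are decomposable regular orthogonal matrices $R_1,\dots,R_s$ of the same order as $R$, each of level at most $2$ (in particular $R_i$ may have the form $\mathrm{diag}(R_i',I)$ with $R_i'$ a smaller regular orthogonal matrix, and may have several non-trivial blocks), such that $R=R_1\cdots R_s$ and such that for every $i<s$ and every adjacency matrix $A=\begin{bmatrix} B&V \\ V^T&W \end{bmatrix}$ all of whose columns of $V$ lie in $\mathcal{V}_R$, the matrix $(Q_1\cdots Q_i)^TA(Q_1\cdots Q_i)$ is an adjacency matrix, where $Q_k=\begin{bmatrix}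 R_k&O \\ O&I \end{bmatrix}$. -}

module Defs where

open import Algebra.Bundles using (CommutativeRing)
import Algebra.Properties.Semiring.Sum as Sum
open import Data.Bool.Base using (Bool; true; false; if_then_else_)
open import Data.Empty using (⊥-elim)
open import Data.Fin.Base using (Fin; toℕ; splitAt; remQuot)
open import Data.Fin.Patterns
open import Data.Fin.Permutation using (Permutation′; _⟨$⟩ʳ_; _⟨$⟩ˡ_; inverseʳ; inverseˡ)
open import Data.Fin.Properties as Fin using (all?)
open import Data.Integer.Base as ℤ using (ℤ; +_; -[1+_])
open import Data.Integer.GCD using (gcd)
open import Data.List.Base using (List; foldr; length; map; take)
open import Data.List.Relation.Unary.All using (All)
open import Data.Nat.Base as ℕ using (ℕ; zero; suc; _≤_; _<_; z≤n; s≤s)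
import Data.Nat.Properties as ℕ
open import Data.Product.Base using (Σ; ∃-syntax; _×_; _,_; proj₁; proj₂)
open import Data.Rational.Base as ℚ using (ℚ; 0ℚ; 1ℚ; ½; _/_; ↥_; ↧_)
import Data.Rational.Properties as ℚ
open import Data.Sum.Base using (_⊎_; inj₁; inj₂)
open import Data.Vec.Base using (Vec; []; _∷_; lookup)
open import Data.Vec.Functional using (Vector; transpose)
open import Level using (0ℓ)
open import Relation.Binary.PropositionalEquality
  using (_≡_; _≢_; refl; sym; trans; cong; cong₂; subst)
open import Relation.Nullary using (¬_; yes; no; does; contradiction)
open import Relation.Nullary.Decidable using (from-yes; dec-true; dec-false)
open import Relation.Unary using (Pred; _∈_)

open Sum (CommutativeRing.semiring ℚ.+-*-commutativeRing) public using (sum)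

private
  variable
    m n p q : ℕ

Matrix : ℕ → ℕ → Set
Matrix m n = Vector (Vector ℚ n) m

infix 4 _≐_
_≐_ : Matrix m n → Matrix m n → Set
M ≐ N = ∀ i j → M i j ≡ N i j

infixl 7 _·_ _·ᵥ_
infixl 9 _ᵀ

_·_ : Matrix m n → Matrix n p → Matrix m p
(M · N) i j = sum λ k → M i k ℚ.* N k j

_·ᵥ_ : Matrix m n → Vector ℚ n → Vector ℚ m
(M ·ᵥ v) i = sum λ k → M i k ℚ.* v k

_ᵀ : Matrix m n → Matrix n m
_ᵀ = transpose

I : Matrix n n
I i j = if does (i Fin.≟ j) then 1ℚ else 0ℚ

J O : Matrix m n
J _ _ = 1ℚ
O _ _ = 0ℚ

∏ : List (Matrix n n) → Matrix n n
∏ = foldr _·_ I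

block : Matrix m n → Matrix m q → Matrix p n → Matrix p q →
        Matrix (m ℕ.+ p) (n ℕ.+ q)
block {m} {n} M₁₁ M₁₂ M₂₁ M₂₂ i j with splitAt m i | splitAt n j
... | inj₁ i | inj₁ j = M₁₁ i j
... | inj₁ i | inj₂ j = M₁₂ i j
... | inj₂ i | inj₁ j = M₂₁ i j
... | inj₂ i | inj₂ j = M₂₂ i j

record RegularOrthogonal (R : Matrix n n) : Set where
  field
    RᵀR≐I    : R ᵀ · R ≐ I
    RRᵀ≐I    : R · R ᵀ ≐ I
    rowSum≡1 : ∀ i → sum (R i) ≡ 1ℚ

IntegralMultiple : ℕ → Matrix m n → Set
IntegralMultiple ℓ M = ∀ i j → ∃[ z ] (+ ℓ / 1) ℚ.* M i j ≡ z / 1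

record HasLevel (M : Matrix m n) (ℓ : ℕ) : Set where
  field
    positive : 1 ≤ ℓ
    integral : IntegralMultiple ℓ M
    smallest : ∀ k → 1 ≤ k → IntegralMultiple k M → ℓ ≤ k

LevelAtMost : ℕ → Matrix m n → Set
LevelAtMost b M = ∃[ ℓ ] HasLevel M ℓ × ℓ ≤ b

-- After permuting rows by σ and columns by τ, the matrix is diag(M₁, M₂)
-- where M₁ and M₂ have orders k and n - k.
-- For orthogonal matrices, diagonal blocks are necessarily square.
Decomposable : Matrix n n → Set
Decomposable {n} M =
  Σ (Permutation′ n) λ σ → Σ (Permutation′ n) λ τ →
  ∃[ k ] 0 < k × k < n ×
    (∀ i j → toℕ i < k → k ≤ toℕ j →
      M (σ ⟨$⟩ʳ i) (τ ⟨$⟩ʳ j) ≡ 0ℚ × M (σ ⟨$⟩ʳ j) (τ ⟨$⟩ʳ i) ≡ 0ℚ)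

record IndecomposableLevel2 (n : ℕ) : Set where
  field
    matrix            : Matrix n n
    regularOrthogonal : RegularOrthogonal matrix
    level≡2           : HasLevel matrix 2
    indecomposable    : ¬ Decomposable matrix

Is01 : ℚ → Set
Is01 x = x ≡ 0ℚ ⊎ x ≡ 1ℚ

record Adjacency (A : Matrix n n) : Set where
  field
    symmetric    : A ᵀ ≐ A
    entries01    : ∀ i j → Is01 (A i j)
    zeroDiagonal : ∀ i → A i i ≡ 0ℚ

𝓥 : Matrix n n → Pred (Vector ℚ n) 0ℓ
𝓥 R v = (∀ i → Is01 (v i)) × (∀ i → Is01 ((R ᵀ ·ᵥ v) i))

𝓑 : Matrix n n → Pred (Matrix n n) 0ℓ
𝓑 R B = Adjacency B × Adjacency (R ᵀ · B · R)

extend : (m : ℕ) → Matrix n n → Matrix (n ℕ.+ m) (n ℕ.+ m)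
extend m R = block R O
                   O (I {m})

record Reducible (R : IndecomposableLevel2 n) (B : Matrix n n) : Set where
  open IndecomposableLevel2 R using (matrix)
  field
    factors             : List (Matrix n n)
    factorsRegular      : All RegularOrthogonal factors
    factorsLevel≤2      : All (LevelAtMost 2) factors
    factorsDecomposable : All Decomposable factors
    factorization       : matrix ≐ ∏ factors
    partialSwitchings   :
      ∀ i → 1 ≤ i → i < length factors →
      ∀ {m} (V : Matrix n m) (W : Matrix m m) →
      (∀ j → (V ᵀ) j ∈ 𝓥 matrix) →
      let A = block B     V
                    (V ᵀ) W
          Q = ∏ (take i (map (extend m) factors))
      in Adjacency A → Adjacency (Q ᵀ · A · Q)

Y : Matrix 2 2
Y i j = (+ 2 / 1) ℚ.* I i j ℚ.- J {2} {2} i j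

R₈-blocks : Vec (Vec (Matrix 2 2) 4) 4
R₈-blocks = (J ∷ O ∷ O ∷ Y ∷ [])
          ∷ (Y ∷ J ∷ O ∷ O ∷ [])
          ∷ (O ∷ Y ∷ J ∷ O ∷ [])
          ∷ (O ∷ O ∷ Y ∷ J ∷ [])
          ∷ []

R₈-matrix : Matrix 8 8
R₈-matrix i j =
  let a , r = remQuot {4} 2 i
      b , s = remQuot {4} 2 j
  in ½ ℚ.* lookup (lookup R₈-blocks a) b r s

abstract

  R₈-regularOrthogonal : RegularOrthogonal R₈-matrix
  R₈-regularOrthogonal = record
    { RᵀR≐I    = from-yes (all? λ i → all? λ j → (R₈-matrix ᵀ · R₈-matrix) i j ℚ.≟ I i j)
    ; RRᵀ≐I    = from-yes (all? λ i → all? λ j → (R₈-matrix · R₈-matrix ᵀ) i j ℚ.≟ I i j)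
    ; rowSum≡1 = from-yes (all? λ i → sum (R₈-matrix i) ℚ.≟ 1ℚ)
    }

  private
    ½-not-integral : ∀ z → ½ ≢ z / 1
    ½-not-integral z eq =
      helper (gcd z (+ 1)) (trans (cong (λ x → ↧ x ℤ.* gcd z (+ 1)) eq) (ℚ.↧-/ z 1))
      where
      helper : ∀ g → + 2 ℤ.* g ≢ + 1
      helper (+ zero)        ()
      helper (+ suc zero)    ()
      helper (+ suc (suc g)) ()
      helper -[1+ g ]        ()

  R₈-level : HasLevel R₈-matrix 2
  R₈-level = record
    { positive = s≤s z≤n
    ; integral = λ i j → ↥ ((+ 2 / 1) ℚ.* R₈-matrix i j) , 2R₈≡ i j
    ; smallest = smallest
    }
    where
    2R₈≡ : ∀ i j → (+ 2 / 1) ℚ.* R₈-matrix i j ≡ ↥ ((+ 2 / 1) ℚ.* R₈-matrix i j) / 1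
    2R₈≡ = from-yes (all? λ i → all? λ j →
      (+ 2 / 1) ℚ.* R₈-matrix i j ℚ.≟ ↥ ((+ 2 / 1) ℚ.* R₈-matrix i j) / 1)

    smallest : ∀ k → 1 ≤ k → IntegralMultiple k R₈-matrix → 2 ≤ k
    smallest (suc zero)    _ int =
      ⊥-elim (½-not-integral (proj₁ (int 0F 0F)) (proj₂ (int 0F 0F)))
    smallest (suc (suc k)) _ _   = s≤s (s≤s z≤n)

  R₈-indecomposable : ¬ Decomposable R₈-matrix
  R₈-indecomposable (σ , τ , k , 0<k , k<8 , zeros) =
    contradiction (trans (sym first) (trans (constant (σ ⟨$⟩ʳ 0F))
                  (trans (sym (constant (σ ⟨$⟩ʳ 7F))) last))) λ ()
    where
    side : Fin 8 → Bool
    side i = does (toℕ i ℕ.<? k)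

    c d : Fin 8 → Bool
    c i = side (σ ⟨$⟩ˡ i)
    d j = side (τ ⟨$⟩ˡ j)

    link : ∀ i j → R₈-matrix i j ≢ 0ℚ → c i ≡ d j
    link i j Rij≢0 with toℕ (σ ⟨$⟩ˡ i) ℕ.<? k | toℕ (τ ⟨$⟩ˡ j) ℕ.<? k
    ... | yes x | yes y = trans (dec-true (_ ℕ.<? k) x) (sym (dec-true (_ ℕ.<? k) y))
    ... | no  x | no  y = trans (dec-false (_ ℕ.<? k) x) (sym (dec-false (_ ℕ.<? k) y))
    ... | yes x | no  y = contradiction
      (subst (_≡ 0ℚ) (cong₂ R₈-matrix (inverseʳ σ) (inverseʳ τ))
        (proj₁ (zeros _ _ x (ℕ.≮⇒≥ y)))) Rij≢0
    ... | no  x | yes y = contradiction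
      (subst (_≡ 0ℚ) (cong₂ R₈-matrix (inverseʳ σ) (inverseʳ τ))
        (proj₂ (zeros _ _ y (ℕ.≮⇒≥ x)))) Rij≢0

    via : ∀ i j i′ → R₈-matrix i j ≢ 0ℚ → R₈-matrix i′ j ≢ 0ℚ → c i ≡ c i′
    via i j i′ x y = trans (link i j x) (sym (link i′ j y))

    constant : ∀ i → c i ≡ c 0F
    constant 0F = refl
    constant 1F = via 1F 0F 0F (λ ()) (λ ())
    constant 2F = via 2F 0F 0F (λ ()) (λ ())
    constant 3F = via 3F 0F 0F (λ ()) (λ ())
    constant 4F = trans (via 4F 2F 2F (λ ()) (λ ())) (constant 2F)
    constant 5F = trans (via 5F 2F 2F (λ ()) (λ ())) (constant 2F)
    constant 6F = via 6F 6F 0F (λ ()) (λ ())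
    constant 7F = via 7F 6F 0F (λ ()) (λ ())

    first : c (σ ⟨$⟩ʳ 0F) ≡ true
    first = trans (cong side (inverseˡ σ)) (dec-true (0 ℕ.<? k) 0<k)

    last : c (σ ⟨$⟩ʳ 7F) ≡ false
    last = trans (cong side (inverseˡ σ))
                 (dec-false (7 ℕ.<? k) (ℕ.≤⇒≯ (ℕ.≤-pred k<8)))

R₈ : IndecomposableLevel2 8
R₈ = record
  { matrix            = R₈-matrix
  ; regularOrthogonal = R₈-regularOrthogonal
  ; level≡2           = R₈-level
  ; indecomposable    = R₈-indecomposable
  }

{-# OPTIONS --safe #-}
module Submission where

-- Let e_b and f_b be the sum and the difference of the two coordinates of pair b, for b in ℤ/4.
-- R₈ fixes every e_b and rotates the f_b: with P_ρ the matrix fixing every e_b and sending f_b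
-- to f_{ρ b}, it is P_π for the rotation π b = b + 1. Hence R₈ = P_τ · P_{τ⁻¹π} for every τ; for
-- each of the five transpositions τ used here, neither τ nor τ⁻¹π is transitive on the pairs, so
-- both factors are decomposable. If B ∈ 𝓑 then every 2 × 2 block of B has an even number of ones,
-- so exactly one of its coordinates ee - 2, ef, fe, ff is nonzero: its kind. Block (a, b) of
-- P_ρᵀ B P_ρ takes ee from block (a, b), ef from (a, ρ b), fe from (ρ a, b) and ff from (ρ a, ρ b),
-- so it is a 01-block exactly when one of these four (with ee - 2 for ee) is nonzero. This leaves
-- a search over the kinds of the blocks, which always finds a τ.

open import Algebra.Bundles using (CommutativeRing)
import Algebra.Properties.Semiring.Sum as Sum
open import Data.Bool.Base using (true; false; if_then_else_)
open import Data.Fin.Base using (Fin; toℕ; combine; remQuot; splitAt; _↑ˡ_; _↑ʳ_)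
open import Data.Fin.Patterns
open import Data.Fin.Permutation as Perm
  using (Permutation′; permutation; transpose; _⟨$⟩ʳ_; _⟨$⟩ˡ_; _∘ₚ_)
open import Data.Fin.Properties as Fin using (all?)
open import Data.Integer.Base as ℤ using (ℤ; +_; -[1+_]; 0ℤ)
import Data.Integer.Properties as ℤ
open import Data.List.Base using (List; []; _∷_)
open import Data.List.Relation.Unary.All as All using (All; []; _∷_)
open import Data.List.Relation.Unary.Any as Any using (Any; any?)
open import Data.Nat.Base as ℕ using (ℕ; zero; suc; _≤_; _<_; z≤n; s≤s)
import Data.Nat.Properties as ℕ
open import Data.Product.Base using (∃-syntax; _×_; _,_; proj₁; proj₂; uncurry)
open import Data.Rational.Base as ℚ using (ℚ; 0ℚ; 1ℚ; ½; _/_; ↥_; ↧_)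
open import Data.Rational.Literals using (fromℤ)
import Data.Rational.Properties as ℚ
open import Data.Rational.Solver using (module +-*-Solver)
open import Data.Sum.Base using (_⊎_; inj₁; inj₂)
open import Data.Vec.Base using (Vec; []; _∷_; lookup)
open import Data.Vec.Functional using (Vector)
open import Defs
open import Function.Base using (_∘_)
open import Function.Bundles using (_⇔_; mk⇔)
open import Relation.Binary.PropositionalEquality
  using (_≡_; _≢_; refl; sym; trans; cong; cong₂; subst; module ≡-Reasoning)
open import Relation.Nullary using (Dec; does; ¬?; contradiction)
open import Relation.Nullary.Decidable
  using (map′; toWitness; True; _×-dec_; _⊎-dec_; _→-dec_; does-⇔; dec-true; dec-false)
open import Relation.Unary using (Decidable; _∈_)

open Sum (CommutativeRing.semiring ℚ.+-*-commutativeRing)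
  using (sum-cong-≗; ∑-distrib-+; ∑-comm; *-distribʳ-sum; sum-replicate-zero)
open +-*-Solver using (solve; _:=_; _:+_; _:*_; :-_; con)
open ≡-Reasoning

private
  variable
    m n p q : ℕ

-- Matrices over ℚ

sum-zero : (f : Vector ℚ n) → (∀ i → f i ≡ 0ℚ) → sum f ≡ 0ℚ
sum-zero {n} f f≡0 = trans (sum-cong-≗ f≡0) (sum-replicate-zero n)

sum-↑ : (f : Vector ℚ (n ℕ.+ m)) → sum f ≡ sum (f ∘ (_↑ˡ m)) ℚ.+ sum (f ∘ (n ↑ʳ_))
sum-↑ {zero}  f = sym (ℚ.+-identityˡ _)
sum-↑ {suc n} f = trans (cong (f 0F ℚ.+_) (sum-↑ {n} (f ∘ Fin.suc))) (sym (ℚ.+-assoc (f 0F) _ _))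

sum-combine : (f : Vector ℚ (n ℕ.* 2)) →
              sum f ≡ sum {n} (λ a → f (combine a 0F) ℚ.+ f (combine a 1F))
sum-combine {zero}  f = refl
sum-combine {suc n} f =
  trans (cong (λ x → f 0F ℚ.+ (f 1F ℚ.+ x)) (sum-combine {n} (f ∘ Fin.suc ∘ Fin.suc)))
        (sym (ℚ.+-assoc (f 0F) (f 1F) _))

sum-I : (x : Vector ℚ n) (j : Fin n) → sum (λ i → I i j ℚ.* x i) ≡ x j
sum-I x 0F =
  trans (cong₂ ℚ._+_ (ℚ.*-identityˡ (x 0F)) (sum-zero _ λ i → ℚ.*-zeroˡ (x (Fin.suc i))))
        (ℚ.+-identityʳ (x 0F))
sum-I x (Fin.suc j) =
  trans (cong₂ ℚ._+_ (ℚ.*-zeroˡ (x 0F)) (sum-I (x ∘ Fin.suc) j)) (ℚ.+-identityˡ _)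

·ᵥ-congʳ : (M : Matrix m n) {v w : Vector ℚ n} → (∀ k → v k ≡ w k) → ∀ i → (M ·ᵥ v) i ≡ (M ·ᵥ w) i
·ᵥ-congʳ M v≗w i = sum-cong-≗ λ k → cong (M i k ℚ.*_) (v≗w k)

·-identityʳ : (M : Matrix m n) → M · I ≐ M
·-identityʳ M i j = trans (sum-cong-≗ λ k → ℚ.*-comm (M i k) (I k j)) (sum-I (M i) j)

-- Reading a conjugate as `Q ᵀ` applied first to the columns of `A` and then along its rows reduces
-- every later computation to a formula for `Q ᵀ ·ᵥ v`.
conjugate-entry : (Q A : Matrix n n) → ∀ i j →
  (Q ᵀ · A · Q) i j ≡ (Q ᵀ ·ᵥ λ k → (Q ᵀ ·ᵥ λ l → A l k) i) j
conjugate-entry Q A i j = sum-cong-≗ λ k → ℚ.*-comm _ (Q k j)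

conjugate-cong : (A : Matrix n n) {Q R : Matrix n n} → Q ≐ R → Q ᵀ · A · Q ≐ R ᵀ · A · R
conjugate-cong A Q≐R i j = sum-cong-≗ λ k → cong₂ ℚ._*_
  (sum-cong-≗ λ l → cong (ℚ._* A l k) (Q≐R l i)) (Q≐R k j)

conjugate-symmetric : (Q A : Matrix n n) → A ᵀ ≐ A → (Q ᵀ · A · Q) ᵀ ≐ Q ᵀ · A · Q
conjugate-symmetric {n} Q A Aᵀ≐A i j = begin
  (sum λ k → sum (λ l → Q l j ℚ.* A l k) ℚ.* Q k i)
    ≡⟨ sum-cong-≗ (λ k → *-distribʳ-sum (Q k i) (λ l → Q l j ℚ.* A l k)) ⟩
  (sum λ k → sum λ l → Q l j ℚ.* A l k ℚ.* Q k i)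
    ≡⟨ ∑-comm {n} {n} (λ k l → Q l j ℚ.* A l k ℚ.* Q k i) ⟩
  (sum λ l → sum λ k → Q l j ℚ.* A l k ℚ.* Q k i)
    ≡⟨ sum-cong-≗ (λ l → sum-cong-≗ λ k → reverse l k) ⟩
  (sum λ l → sum λ k → Q k i ℚ.* A k l ℚ.* Q l j)
    ≡⟨ sum-cong-≗ (λ l → sym (*-distribʳ-sum (Q l j) (λ k → Q k i ℚ.* A k l))) ⟩
  (sum λ l → sum (λ k → Q k i ℚ.* A k l) ℚ.* Q l j) ∎
  where
  reverse : ∀ l k → Q l j ℚ.* A l k ℚ.* Q k i ≡ Q k i ℚ.* A k l ℚ.* Q l j
  reverse l k = trans (cong (λ a → Q l j ℚ.* a ℚ.* Q k i) (Aᵀ≐A k l))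
    (solve 3 (λ x y z → x :* y :* z := z :* y :* x) refl (Q l j) (A k l) (Q k i))

Adjacency-resp-≐ : {A B : Matrix n n} → A ≐ B → Adjacency A → Adjacency B
Adjacency-resp-≐ A≐B adj = record
  { symmetric    = λ i j → trans (sym (A≐B j i)) (trans (symmetric i j) (A≐B i j))
  ; entries01    = λ i j → subst Is01 (A≐B i j) (entries01 i j)
  ; zeroDiagonal = λ i → trans (sym (A≐B i i)) (zeroDiagonal i)
  }
  where open Adjacency adj

-- Conjugation of a bordered matrix

↑-elim : (P : Fin (n ℕ.+ m) → Set) → (∀ i → P (i ↑ˡ m)) → (∀ j → P (n ↑ʳ j)) → ∀ k → P k
↑-elim {n} {m} P left right k with splitAt n k | Fin.join-splitAt n m k
... | inj₁ i | refl = left i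
... | inj₂ j | refl = right j

module _ (A : Matrix m n) (B : Matrix m q) (C : Matrix p n) (D : Matrix p q) where

  block-↑ˡ-↑ˡ : ∀ i j → block A B C D (i ↑ˡ p) (j ↑ˡ q) ≡ A i j
  block-↑ˡ-↑ˡ i j rewrite Fin.splitAt-↑ˡ m i p | Fin.splitAt-↑ˡ n j q = refl

  block-↑ˡ-↑ʳ : ∀ i j → block A B C D (i ↑ˡ p) (n ↑ʳ j) ≡ B i j
  block-↑ˡ-↑ʳ i j rewrite Fin.splitAt-↑ˡ m i p | Fin.splitAt-↑ʳ n q j = refl

  block-↑ʳ-↑ˡ : ∀ i j → block A B C D (m ↑ʳ i) (j ↑ˡ q) ≡ C i j
  block-↑ʳ-↑ˡ i j rewrite Fin.splitAt-↑ʳ m p i | Fin.splitAt-↑ˡ n j q = refl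

  block-↑ʳ-↑ʳ : ∀ i j → block A B C D (m ↑ʳ i) (n ↑ʳ j) ≡ D i j
  block-↑ʳ-↑ʳ i j rewrite Fin.splitAt-↑ʳ m p i | Fin.splitAt-↑ʳ n q j = refl

module _ (P : Matrix n n) (v : Vector ℚ (n ℕ.+ m)) where

  extendᵀ-↑ˡ : ∀ i → (extend m P ᵀ ·ᵥ v) (i ↑ˡ m) ≡ (P ᵀ ·ᵥ (v ∘ (_↑ˡ m))) i
  extendᵀ-↑ˡ i = trans (sum-↑ {n} {m} _) (trans (cong₂ ℚ._+_
    (sum-cong-≗ λ k → cong (ℚ._* v (k ↑ˡ m)) (block-↑ˡ-↑ˡ P O O I k i))
    (sum-zero _ λ k → trans (cong (ℚ._* v (n ↑ʳ k)) (block-↑ʳ-↑ˡ P O O I k i)) (ℚ.*-zeroˡ (v (n ↑ʳ k)))))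
    (ℚ.+-identityʳ _))

  extendᵀ-↑ʳ : ∀ j → (extend m P ᵀ ·ᵥ v) (n ↑ʳ j) ≡ v (n ↑ʳ j)
  extendᵀ-↑ʳ j = trans (sum-↑ {n} {m} _) (trans (cong₂ ℚ._+_
    (sum-zero _ λ k → trans (cong (ℚ._* v (k ↑ˡ m)) (block-↑ˡ-↑ʳ P O O I k j)) (ℚ.*-zeroˡ (v (k ↑ˡ m))))
    (trans (sum-cong-≗ λ k → cong (ℚ._* v (n ↑ʳ k)) (block-↑ʳ-↑ʳ P O O I k j))
           (sum-I (v ∘ (n ↑ʳ_)) j)))
    (ℚ.+-identityˡ _))

module _ (P B : Matrix n n) (V : Matrix n m) (W : Matrix m m) where

  private
    A = block B V (V ᵀ) W
    Q = extend m P

  -- The conjugate has the blocks `P ᵀ · B · P`, `P ᵀ · V`, the transpose of the latter, and `W`.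
  -- The first hypothesis settles the first block, the second settles `P ᵀ · V`, symmetry carries
  -- this to the lower left, and `W` is inherited from `A`.
  extend-conjugate-adjacency :
    Adjacency (P ᵀ · B · P) → (∀ j i → Is01 ((P ᵀ ·ᵥ (V ᵀ) j) i)) →
    Adjacency A → Adjacency (Q ᵀ · A · Q)
  extend-conjugate-adjacency adjB binV adjA = record
    { symmetric    = symmetricQAQ
    ; entries01    = ↑-elim _
        (λ i → ↑-elim _ (λ j → subst Is01 (sym (↑ˡ-↑ˡ i j)) (Adjacency.entries01 adjB i j))
                        (λ j → subst Is01 (sym (↑ˡ-↑ʳ i j)) (binV j i)))
        (λ i → ↑-elim _ (λ j → subst Is01 (trans (sym (↑ˡ-↑ʳ j i)) (symmetricQAQ (n ↑ʳ i) (j ↑ˡ m)))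
                                          (binV i j))
                        (λ j → subst Is01 (sym (↑ʳ-↑ʳ i j)) (Adjacency.entries01 adjA _ _)))
    ; zeroDiagonal = ↑-elim _
        (λ i → trans (↑ˡ-↑ˡ i i) (Adjacency.zeroDiagonal adjB i))
        (λ j → trans (↑ʳ-↑ʳ j j) (Adjacency.zeroDiagonal adjA _))
    }
    where
    symmetricQAQ : (Q ᵀ · A · Q) ᵀ ≐ Q ᵀ · A · Q
    symmetricQAQ = conjugate-symmetric Q A (Adjacency.symmetric adjA)

    ↑ˡ-↑ˡ : ∀ i j → (Q ᵀ · A · Q) (i ↑ˡ m) (j ↑ˡ m) ≡ (P ᵀ · B · P) i j
    ↑ˡ-↑ˡ i j = begin
      (Q ᵀ · A · Q) (i ↑ˡ m) (j ↑ˡ m)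
        ≡⟨ conjugate-entry Q A (i ↑ˡ m) (j ↑ˡ m) ⟩
      _ ≡⟨ extendᵀ-↑ˡ P (λ k → (Q ᵀ ·ᵥ λ l → A l k) (i ↑ˡ m)) j ⟩
      (P ᵀ ·ᵥ λ k → (Q ᵀ ·ᵥ λ l → A l (k ↑ˡ m)) (i ↑ˡ m)) j
        ≡⟨ ·ᵥ-congʳ (P ᵀ) (λ k → trans
             (extendᵀ-↑ˡ P (λ l → A l (k ↑ˡ m)) i)
             (·ᵥ-congʳ (P ᵀ) (λ l → block-↑ˡ-↑ˡ B V (V ᵀ) W l k) i)) j ⟩
      (P ᵀ ·ᵥ λ k → (P ᵀ ·ᵥ λ l → B l k) i) j
        ≡⟨ conjugate-entry P B i j ⟨
      (P ᵀ · B · P) i j ∎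

    ↑ˡ-↑ʳ : ∀ i j → (Q ᵀ · A · Q) (i ↑ˡ m) (n ↑ʳ j) ≡ (P ᵀ ·ᵥ (V ᵀ) j) i
    ↑ˡ-↑ʳ i j = begin
      (Q ᵀ · A · Q) (i ↑ˡ m) (n ↑ʳ j)
        ≡⟨ conjugate-entry Q A (i ↑ˡ m) (n ↑ʳ j) ⟩
      _ ≡⟨ extendᵀ-↑ʳ P (λ k → (Q ᵀ ·ᵥ λ l → A l k) (i ↑ˡ m)) j ⟩
      (Q ᵀ ·ᵥ λ l → A l (n ↑ʳ j)) (i ↑ˡ m)
        ≡⟨ extendᵀ-↑ˡ P (λ l → A l (n ↑ʳ j)) i ⟩
      (P ᵀ ·ᵥ λ l → A (l ↑ˡ m) (n ↑ʳ j)) i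
        ≡⟨ ·ᵥ-congʳ (P ᵀ) (λ l → block-↑ˡ-↑ʳ B V (V ᵀ) W l j) i ⟩
      (P ᵀ ·ᵥ (V ᵀ) j) i ∎

    ↑ʳ-↑ʳ : ∀ i j → (Q ᵀ · A · Q) (n ↑ʳ i) (n ↑ʳ j) ≡ A (n ↑ʳ i) (n ↑ʳ j)
    ↑ʳ-↑ʳ i j = begin
      (Q ᵀ · A · Q) (n ↑ʳ i) (n ↑ʳ j)
        ≡⟨ conjugate-entry Q A (n ↑ʳ i) (n ↑ʳ j) ⟩
      _ ≡⟨ extendᵀ-↑ʳ P (λ k → (Q ᵀ ·ᵥ λ l → A l k) (n ↑ʳ i)) j ⟩
      _ ≡⟨ extendᵀ-↑ʳ P (λ l → A l (n ↑ʳ j)) i ⟩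
      A (n ↑ʳ i) (n ↑ʳ j) ∎

-- Binary blocks and their kinds

Bits : ℕ → Set
Bits = Vec (Fin 2)

∀bits? : ∀ n {P : Bits n → Set} → Decidable P → Dec (∀ xs → P xs)
∀bits? zero    P? = map′ (λ { p [] → p }) (λ p → p []) (P? [])
∀bits? (suc n) P? = map′ (λ { p (x ∷ xs) → p x xs }) (λ p x xs → p (x ∷ xs))
                         (all? λ x → ∀bits? n λ xs → P? (x ∷ xs))

other : Fin 2 → Fin 2
other 0F = 1F
other 1F = 0F

-- Coordinate s of 2 P_ρᵀ v in pair b, where x and y are the pairs b and ρ b of v.
double : Fin 2 → (x y : Fin 2 → ℤ) → ℤ
double s x y = (x 0F ℤ.+ x 1F) ℤ.+ (y s ℤ.- y (other s))

Block : Set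
Block = Bits 4

⟦_⟧ : Block → Fin 2 → Fin 2 → ℤ
⟦ A ⟧ r s = + toℕ (lookup A (combine r s))

-- Block (a , b) of 4 P_ρᵀ B P_ρ, from the blocks (a , b), (a , ρ b), (ρ a , b), (ρ a , ρ b) of B.
mix : (A B C D : Block) → Fin 2 → Fin 2 → ℤ
mix A B C D r s = double s (λ q → double r (λ p → ⟦ A ⟧ p q) (λ p → ⟦ C ⟧ p q))
                           (λ q → double r (λ p → ⟦ B ⟧ p q) (λ p → ⟦ D ⟧ p q))

hollowBlock : Fin 2 → Block
hollowBlock x = 0F ∷ x ∷ x ∷ 0F ∷ []

infixl 9 _ᵗ
_ᵗ : Block → Block
(p ∷ q ∷ r ∷ s ∷ []) ᵗ = p ∷ r ∷ q ∷ s ∷ []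

differ : Fin 2 → Fin 2 → Fin 2
differ x y = if does (x Fin.≟ y) then 0F else 1F

-- Equal row parities: the block has an even number of ones.
Even : Block → Set
Even (p ∷ q ∷ r ∷ s ∷ []) = differ p q ≡ differ r s

even? : Decidable Even
even? (p ∷ q ∷ r ∷ s ∷ []) = differ p q Fin.≟ differ r s

Kind : Set
Kind = Fin 4

-- Sum or difference over the rows, then over the columns.
pattern ee = 0F
pattern ef = 1F
pattern fe = 2F
pattern ff = 3F

-- The nonzero coordinate of an even block, up to sign; ee means that the block is constant.
kind : Block → Kind
kind (p ∷ q ∷ r ∷ _) = combine (differ p r) (differ p q)

swap : Kind → Kind
swap ee = ee
swap ef = fe
swap fe = ef
swap ff = ff

0or : ℤ → ℤ → Set
0or k z = z ≡ 0ℤ ⊎ z ≡ k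

0or? : ∀ k → Decidable (0or k)
0or? k z = (z ℤ.≟ 0ℤ) ⊎-dec (z ℤ.≟ k)

-- The 4 is the factor by which `mix` scales the entries of the conjugate.
Binary Hollow : (Fin 2 → Fin 2 → ℤ) → Set
Binary A = ∀ r s → 0or (+ 4) (A r s)
Hollow A = ∀ r → A r r ≡ 0ℤ

binary? : Decidable Binary
binary? A = all? λ r → all? λ s → 0or? (+ 4) (A r s)

hollow? : Decidable Hollow
hollow? A = all? λ r → A r r ℤ.≟ 0ℤ

indicator : Kind → Kind → ℕ
indicator k l = if does (k Fin.≟ l) then 1 else 0

One : (A B C D : Kind) → Set
One A B C D = (indicator ee A ℕ.+ indicator ef B) ℕ.+ (indicator fe C ℕ.+ indicator ff D) ≡ 1

one? : ∀ A B C D → Dec (One A B C D)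
one? A B C D = _ ℕ.≟ 1

-- Finite facts about blocks

abstract
  -- Let d be the `ef` coordinate of `B`, which is also the `fe` coordinate of `B ᵗ`. The hollow
  -- blocks contribute 2x through `ee` and -2y through `ff`, so the two diagonal entries are 2x - 2y
  -- + 2d and 2x - 2y - 2d. Both vanish only if x = y and d = 0, and d has the parity of the number
  -- of ones in `B`.
  hollow⇒ : ∀ x y B → Hollow (mix (hollowBlock x) B (B ᵗ) (hollowBlock y)) →
            x ≡ y × Even B × kind B ≢ ef
  hollow⇒ = toWitness {a? = all? λ x → all? λ y → ∀bits? 4 λ B →
    hollow? (mix (hollowBlock x) B (B ᵗ) (hollowBlock y)) →-dec
    (x Fin.≟ y ×-dec even? B ×-dec ¬? (kind B Fin.≟ ef))} _

  ⇒hollow : ∀ x B → Even B → kind B ≢ ef →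
            Hollow (mix (hollowBlock x) B (B ᵗ) (hollowBlock x))
  ⇒hollow = toWitness {a? = all? λ x → ∀bits? 4 λ B → even? B →-dec ¬? (kind B Fin.≟ ef) →-dec
    hollow? (mix (hollowBlock x) B (B ᵗ) (hollowBlock x))} _

  -- Modulo 2 each coordinate of a block is its number of ones, so a single entry of `mix` decides
  -- the parity of the fourth block. Each evenness hypothesis directly follows its block so that the
  -- enumeration drops odd blocks early.
  even-mix : ∀ A → Even A → ∀ C → Even C → ∀ D → Even D →
             ∀ B → 0or (+ 4) (mix A B C D 0F 0F) → Even B
  even-mix = toWitness {a? =
    ∀bits? 4 λ A → even? A →-dec ∀bits? 4 λ C → even? C →-dec
    ∀bits? 4 λ D → even? D →-dec ∀bits? 4 λ B →
    0or? (+ 4) (mix A B C D 0F 0F) →-dec even? B} _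

  -- Subtracting 2 from the entries of `mix` leaves a combination of the four sign patterns 1,
  -- (-1)^s, (-1)^r and (-1)^(r+s), whose coefficients are the `ee` - 2 of `A`, `ef` of `B`, `fe` of
  -- `C` and `ff` of `D`, each 0 or ±2. The patterns are orthogonal, so the mean square of the four
  -- entries is 4 times the number of nonzero coefficients; entries ±2 force that number to be 1.
  -- The converse `one⇒binary` is immediate from the same expansion.
  binary⇒one : ∀ A → Even A → ∀ B → Even B → ∀ C → Even C → ∀ D → Even D →
               Binary (mix A B C D) → One (kind A) (kind B) (kind C) (kind D)
  binary⇒one = toWitness {a? =
    ∀bits? 4 λ A → even? A →-dec ∀bits? 4 λ B → even? B →-dec
    ∀bits? 4 λ C → even? C →-dec ∀bits? 4 λ D → even? D →-dec
    binary? (mix A B C D) →-dec one? (kind A) (kind B) (kind C) (kind D)} _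

  one⇒binary : ∀ A → Even A → ∀ B → Even B → ∀ C → Even C → ∀ D → Even D →
               One (kind A) (kind B) (kind C) (kind D) → Binary (mix A B C D)
  one⇒binary = toWitness {a? =
    ∀bits? 4 λ A → even? A →-dec ∀bits? 4 λ B → even? B →-dec
    ∀bits? 4 λ C → even? C →-dec ∀bits? 4 λ D → even? D →-dec
    one? (kind A) (kind B) (kind C) (kind D) →-dec binary? (mix A B C D)} _

  kind-ᵗ : ∀ A → Even A → Even (A ᵗ) × kind (A ᵗ) ≡ swap (kind A)
  kind-ᵗ = toWitness {a? = ∀bits? 4 λ A → even? A →-dec
    (even? (A ᵗ) ×-dec kind (A ᵗ) Fin.≟ swap (kind A))} _

  hollowBlock-even : ∀ x → Even (hollowBlock x)
  hollowBlock-even = toWitness {a? = all? λ x → even? (hollowBlock x)} _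

-- Admissible permutations and the search over kinds

Kinds : Set
Kinds = Fin 4 → Fin 4 → Kind

-- What `Switchable` amounts to once all blocks are even and all diagonal blocks agree: the first
-- condition makes the diagonal hollow, the second makes every block binary.
Admissible : Permutation′ 4 → Kinds → Set
Admissible ρ K = (∀ a → K a (ρ ⟨$⟩ʳ a) ≢ ef)
               × (∀ a b → One (K a b) (K a (ρ ⟨$⟩ʳ b)) (K (ρ ⟨$⟩ʳ a) b) (K (ρ ⟨$⟩ʳ a) (ρ ⟨$⟩ʳ b)))

admissible? : ∀ ρ → Decidable (Admissible ρ)
admissible? ρ K = (all? λ a → ¬? (K a (ρ ⟨$⟩ʳ a) Fin.≟ ef))
            ×-dec (all? λ a → all? λ b → one? (K a b) (K a (ρ ⟨$⟩ʳ b)) (K (ρ ⟨$⟩ʳ a) b) (K (ρ ⟨$⟩ʳ a) (ρ ⟨$⟩ʳ b)))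

admissible-cong : ∀ ρ {K L : Kinds} → (∀ a b → K a b ≡ L a b) → Admissible ρ K → Admissible ρ L
admissible-cong ρ {K} {L} K≗L (K≢ef , one) =
  (λ a → K≢ef a ∘ trans (K≗L a (ρ ⟨$⟩ʳ a))) ,
  (λ a b → one-cong (K≗L a b) (K≗L a (ρ ⟨$⟩ʳ b)) (K≗L (ρ ⟨$⟩ʳ a) b) (K≗L (ρ ⟨$⟩ʳ a) (ρ ⟨$⟩ʳ b)) (one a b))
  where
  one-cong : ∀ {A A′ B B′ C C′ D D′} → A ≡ A′ → B ≡ B′ → C ≡ C′ → D ≡ D′ → One A B C D → One A′ B′ C′ D′
  one-cong refl refl refl refl one = one

rotation : Permutation′ 4
rotation = permutation (lookup (1F ∷ 2F ∷ 3F ∷ 0F ∷ [])) (lookup (3F ∷ 0F ∷ 1F ∷ 2F ∷ []))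
  (toWitness {a? = all? λ _ → _ Fin.≟ _} _) (toWitness {a? = all? λ _ → _ Fin.≟ _} _)

-- Transposing a block exchanges `ef` and `fe`, so six kinds off the diagonal determine the others.
-- The parameter is `k₃₀`, not the kind of block (0, 3), because the restriction `≢ ef` concerns the
-- blocks (a, a + 1) modulo 4.
symmetricKinds : (d k₀₁ k₁₂ k₂₃ k₃₀ k₀₂ k₁₃ : Kind) → Kinds
symmetricKinds d k₀₁ k₁₂ k₂₃ k₃₀ k₀₂ k₁₃ = λ
  { 0F 0F → d        ; 0F 1F → k₀₁      ; 0F 2F → k₀₂      ; 0F 3F → swap k₃₀
  ; 1F 0F → swap k₀₁ ; 1F 1F → d        ; 1F 2F → k₁₂      ; 1F 3F → k₁₃
  ; 2F 0F → swap k₀₂ ; 2F 1F → swap k₁₂ ; 2F 2F → d        ; 2F 3F → k₂₃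
  ; 3F 0F → k₃₀      ; 3F 1F → swap k₁₃ ; 3F 2F → swap k₂₃ ; 3F 3F → d
  }

-- The four transpositions of cyclically adjacent pairs, and one transposition of opposite pairs.
candidates : List (Permutation′ 4)
candidates = transpose 0F 1F ∷ transpose 1F 2F ∷ transpose 2F 3F ∷ transpose 3F 0F ∷ transpose 1F 3F ∷ []

abstract
  -- Settled by enumerating 2 * 3^4 * 4^2 arrays: two possible diagonals, three kinds for each of
  -- the four blocks (a, a + 1), and four kinds for each of the blocks (0, 2) and (1, 3).
  search : ∀ x k₀₁ → k₀₁ ≢ ef → ∀ k₁₂ → k₁₂ ≢ ef → ∀ k₂₃ → k₂₃ ≢ ef → ∀ k₃₀ → k₃₀ ≢ ef → ∀ k₀₂ k₁₃ →
    let K = symmetricKinds (kind (hollowBlock x)) k₀₁ k₁₂ k₂₃ k₃₀ k₀₂ k₁₃ in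
    Admissible rotation K → Any (λ ρ → Admissible ρ K) candidates
  search = toWitness {a? = all? λ x →
    all? λ k₀₁ → ¬? (k₀₁ Fin.≟ ef) →-dec all? λ k₁₂ → ¬? (k₁₂ Fin.≟ ef) →-dec
    all? λ k₂₃ → ¬? (k₂₃ Fin.≟ ef) →-dec all? λ k₃₀ → ¬? (k₃₀ Fin.≟ ef) →-dec
    all? λ k₀₂ → all? λ k₁₃ →
    let K = symmetricKinds (kind (hollowBlock x)) k₀₁ k₁₂ k₂₃ k₃₀ k₀₂ k₁₃ in
    admissible? rotation K →-dec any? (λ ρ → admissible? ρ K) candidates} _

switch : Permutation′ 4 → (Fin 4 → Fin 4 → Block) → Fin 4 → Fin 4 → Fin 2 → Fin 2 → ℤ
switch ρ G a b = mix (G a b) (G a (ρ ⟨$⟩ʳ b)) (G (ρ ⟨$⟩ʳ a) b) (G (ρ ⟨$⟩ʳ a) (ρ ⟨$⟩ʳ b))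

record Switchable (G : Fin 4 → Fin 4 → Block) (ρ : Permutation′ 4) : Set where
  field
    hollow : ∀ a → Hollow (switch ρ G a a)
    binary : ∀ a b → Binary (switch ρ G a b)

module _ (G : Fin 4 → Fin 4 → Block) (x : Fin 4 → Fin 2)
         (transposed : ∀ a b → G b a ≡ G a b ᵗ)
         (diagonal : ∀ a → G a a ≡ hollowBlock (x a)) where

  switch-diagonal : ∀ ρ a → let b = ρ ⟨$⟩ʳ a in
    switch ρ G a a ≡ mix (hollowBlock (x a)) (G a b) (G a b ᵗ) (hollowBlock (x b))
  switch-diagonal ρ a
    rewrite diagonal a | diagonal (ρ ⟨$⟩ʳ a) | transposed a (ρ ⟨$⟩ʳ a) = refl

  module _ (switchable : Switchable G rotation) where
    open Switchable switchable

    private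
      next : Fin 4 → Fin 4
      next = rotation ⟨$⟩ʳ_

      K : Kinds
      K a b = kind (G a b)

      rotated : ∀ a → x a ≡ x (next a) × Even (G a (next a)) × K a (next a) ≢ ef
      rotated a = hollow⇒ (x a) (x (next a)) (G a (next a))
        (subst Hollow (switch-diagonal rotation a) (hollow a))

      -- The rotation is transitive on the pairs, so equality of successive bits makes all diagonal
      -- blocks equal.
      x-constant : ∀ a → x a ≡ x 0F
      x-constant 0F = refl
      x-constant 1F = sym (proj₁ (rotated 0F))
      x-constant 2F = trans (sym (proj₁ (rotated 1F))) (x-constant 1F)
      x-constant 3F = proj₁ (rotated 3F)

      -- Evenness of block (a, b) is proved according to b - a modulo 4: difference 0 is a hollow
      -- block, 1 comes from the hollow diagonal of the switched array, 2 from its binary entries,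
      -- and 3 from 1 by transposition.
      even₀ : ∀ a → Even (G a a)
      even₀ a = subst Even (sym (diagonal a)) (hollowBlock-even (x a))

      even₁ : ∀ a → Even (G a (next a))
      even₁ a = proj₁ (proj₂ (rotated a))

      -- The switched block (a, a + 1) mixes the blocks (a, a + 1), (a, a + 2), (a + 1, a + 1) and
      -- (a + 1, a + 2); all but the second are already known to be even.
      even₂ : ∀ a → Even (G a (next (next a)))
      even₂ a = even-mix _ (even₁ a) _ (even₀ (next a)) _ (even₁ (next a)) _ (binary a (next a) 0F 0F)

      even₃ : ∀ a → Even (G (next a) a)
      even₃ a = subst Even (sym (transposed a (next a))) (proj₁ (kind-ᵗ _ (even₁ a)))

      even : ∀ a b → Even (G a b)
      even 0F 0F = even₀ 0F
      even 0F 1F = even₁ 0F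
      even 0F 2F = even₂ 0F
      even 0F 3F = even₃ 3F
      even 1F 0F = even₃ 0F
      even 1F 1F = even₀ 1F
      even 1F 2F = even₁ 1F
      even 1F 3F = even₂ 1F
      even 2F 0F = even₂ 2F
      even 2F 1F = even₃ 1F
      even 2F 2F = even₀ 2F
      even 2F 3F = even₁ 2F
      even 3F 0F = even₁ 3F
      even 3F 1F = even₂ 3F
      even 3F 2F = even₃ 2F
      even 3F 3F = even₀ 3F

      K-diagonal : ∀ a → K a a ≡ kind (hollowBlock (x 0F))
      K-diagonal a = cong kind (trans (diagonal a) (cong hollowBlock (x-constant a)))

      K-transposed : ∀ a b → K b a ≡ swap (K a b)
      K-transposed a b = trans (cong kind (transposed a b)) (proj₂ (kind-ᵗ _ (even a b)))

      K′ : Kinds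
      K′ = symmetricKinds (kind (hollowBlock (x 0F)))
             (K 0F 1F) (K 1F 2F) (K 2F 3F) (K 3F 0F) (K 0F 2F) (K 1F 3F)

      K≗K′ : ∀ a b → K a b ≡ K′ a b
      K≗K′ 0F 0F = K-diagonal 0F
      K≗K′ 0F 1F = refl
      K≗K′ 0F 2F = refl
      K≗K′ 0F 3F = K-transposed 3F 0F
      K≗K′ 1F 0F = K-transposed 0F 1F
      K≗K′ 1F 1F = K-diagonal 1F
      K≗K′ 1F 2F = refl
      K≗K′ 1F 3F = refl
      K≗K′ 2F 0F = K-transposed 0F 2F
      K≗K′ 2F 1F = K-transposed 1F 2F
      K≗K′ 2F 2F = K-diagonal 2F
      K≗K′ 2F 3F = refl
      K≗K′ 3F 0F = refl
      K≗K′ 3F 1F = K-transposed 1F 3F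
      K≗K′ 3F 2F = K-transposed 2F 3F
      K≗K′ 3F 3F = K-diagonal 3F

      admissible : Admissible rotation K
      admissible = (λ a → proj₂ (proj₂ (rotated a))) , λ a b →
        binary⇒one _ (even a b) _ (even a _) _ (even _ b) _ (even _ _) (binary a b)

      admissible⇒switchable : ∀ {ρ} → Admissible ρ K → Switchable G ρ
      admissible⇒switchable {ρ} (K≢ef , one) = record
        { hollow = λ a → subst Hollow (sym (switch-diagonal ρ a))
            (subst (λ y → Hollow (mix (hollowBlock (x a)) (G a (ρ ⟨$⟩ʳ a)) (G a (ρ ⟨$⟩ʳ a) ᵗ) (hollowBlock y)))
              -- `⇒hollow` asks for the same bit at `a` and `ρ ⟨$⟩ʳ a`; equality of all diagonal
              -- blocks provides it for every `ρ`.
              (trans (x-constant a) (sym (x-constant (ρ ⟨$⟩ʳ a))))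
              (⇒hollow (x a) (G a (ρ ⟨$⟩ʳ a)) (even a _) (K≢ef a)))
        ; binary = λ a b → one⇒binary _ (even a b) _ (even a _) _ (even _ b) _ (even _ _) (one a b)
        }

    candidate-switchable : Any (Switchable G) candidates
    candidate-switchable = Any.map
      (λ {ρ} adm → admissible⇒switchable {ρ} (admissible-cong ρ (λ a b → sym (K≗K′ a b)) adm))
      (search (x 0F) (K 0F 1F) (proj₂ (proj₂ (rotated 0F))) (K 1F 2F) (proj₂ (proj₂ (rotated 1F)))
        (K 2F 3F) (proj₂ (proj₂ (rotated 2F))) (K 3F 0F) (proj₂ (proj₂ (rotated 3F)))
        (K 0F 2F) (K 1F 3F) (admissible-cong rotation K≗K′ admissible))

-- Permuting the differences of paired coordinates

pair : Fin 4 → Fin 2 → Fin 8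
pair = combine

ε : Fin 2 → Fin 2 → ℚ
ε r s = if does (r Fin.≟ s) then 1ℚ else ℚ.- 1ℚ

-- The matrix P_ρ.
permuteDifferencesEntry : Permutation′ 4 → Fin 4 × Fin 2 → Fin 4 × Fin 2 → ℚ
permuteDifferencesEntry ρ (a , r) (b , s) = ½ ℚ.* (I a b ℚ.+ ε r s ℚ.* I a (ρ ⟨$⟩ʳ b))

permuteDifferences : Permutation′ 4 → Matrix 8 8
permuteDifferences ρ i j = permuteDifferencesEntry ρ (remQuot {4} 2 i) (remQuot {4} 2 j)

combine-elim : (P : Fin 8 → Set) → (∀ a r → P (pair a r)) → ∀ i → P i
combine-elim P p i = subst P (Fin.combine-remQuot {4} 2 i) (uncurry p (remQuot {4} 2 i))

combine-elim₂ : (P : Fin 8 → Fin 8 → Set) →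
  (∀ a r b s → P (pair a r) (pair b s)) → ∀ i j → P i j
combine-elim₂ P p = combine-elim _ λ a r → combine-elim _ λ b s → p a r b s

permuteDifferences-combine : ∀ ρ a r b s →
  permuteDifferences ρ (pair a r) (pair b s) ≡ ½ ℚ.* (I a b ℚ.+ ε r s ℚ.* I a (ρ ⟨$⟩ʳ b))
permuteDifferences-combine ρ a r b s =
  cong₂ (permuteDifferencesEntry ρ) (Fin.remQuot-combine {4} a r) (Fin.remQuot-combine {4} b s)

doubleℚ : Fin 2 → (x y : Fin 2 → ℚ) → ℚ
doubleℚ s x y = (x 0F ℚ.+ x 1F) ℚ.+ (y s ℚ.- y (other s))

doubleℚ-cong : ∀ s {x x′ y y′ : Fin 2 → ℚ} → (∀ r → x r ≡ x′ r) → (∀ r → y r ≡ y′ r) →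
               doubleℚ s x y ≡ doubleℚ s x′ y′
doubleℚ-cong s x≗x′ y≗y′ = cong₂ ℚ._+_ (cong₂ ℚ._+_ (x≗x′ 0F) (x≗x′ 1F))
                                       (cong₂ ℚ._-_ (y≗y′ s) (y≗y′ (other s)))

-- Column (b, s) of the matrix is half of e_b plus or minus f_{ρ b}, so its product with `v` sees
-- only the sum over pair `b` and the difference over pair `ρ ⟨$⟩ʳ b`.
permuteDifferencesᵀ : ∀ ρ v b s →
  (permuteDifferences ρ ᵀ ·ᵥ v) (pair b s) ≡
  ½ ℚ.* doubleℚ s (λ r → v (pair b r)) (λ r → v (pair (ρ ⟨$⟩ʳ b) r))
permuteDifferencesᵀ ρ v b s = begin
  (permuteDifferences ρ ᵀ ·ᵥ v) (pair b s)
    ≡⟨ sum-combine {4} (λ k → permuteDifferences ρ k (pair b s) ℚ.* v k) ⟩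
  sum summand
    ≡⟨ sum-cong-≗ {4} {summand} {λ a → evenSummand a ℚ.+ oddSummand a} (λ a → trans
         (cong₂ (λ x y → x ℚ.* v (pair a 0F) ℚ.+ y ℚ.* v (pair a 1F))
           (permuteDifferences-combine ρ a 0F b s) (permuteDifferences-combine ρ a 1F b s))
         (collect (I a b) (I a (ρ ⟨$⟩ʳ b)) (λ r → v (pair a r)) s)) ⟩
  (sum λ a → evenSummand a ℚ.+ oddSummand a)
    ≡⟨ ∑-distrib-+ evenSummand oddSummand ⟩
  sum evenSummand ℚ.+ sum oddSummand
    ≡⟨ cong₂ ℚ._+_ (sum-I evenPart b) (sum-I oddPart (ρ ⟨$⟩ʳ b)) ⟩
  evenPart b ℚ.+ oddPart (ρ ⟨$⟩ʳ b)
    ≡⟨ ℚ.*-distribˡ-+ ½ (v (pair b 0F) ℚ.+ v (pair b 1F)) _ ⟨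
  ½ ℚ.* doubleℚ s (λ r → v (pair b r)) (λ r → v (pair (ρ ⟨$⟩ʳ b) r)) ∎
  where
  evenPart oddPart : Vector ℚ 4
  evenPart a = ½ ℚ.* (v (pair a 0F) ℚ.+ v (pair a 1F))
  oddPart  a = ½ ℚ.* (v (pair a s) ℚ.- v (pair a (other s)))

  summand evenSummand oddSummand : Vector ℚ 4
  summand     a = permuteDifferences ρ (pair a 0F) (pair b s) ℚ.* v (pair a 0F) ℚ.+
                  permuteDifferences ρ (pair a 1F) (pair b s) ℚ.* v (pair a 1F)
  evenSummand a = I a b ℚ.* evenPart a
  oddSummand  a = I a (ρ ⟨$⟩ʳ b) ℚ.* oddPart a

  collect : ∀ i j (w : Fin 2 → ℚ) s →
    ½ ℚ.* (i ℚ.+ ε 0F s ℚ.* j) ℚ.* w 0F ℚ.+ ½ ℚ.* (i ℚ.+ ε 1F s ℚ.* j) ℚ.* w 1F ≡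
    i ℚ.* (½ ℚ.* (w 0F ℚ.+ w 1F)) ℚ.+ j ℚ.* (½ ℚ.* (w s ℚ.- w (other s)))
  collect i j w 0F = solve 4 (λ i j x y →
    con ½ :* (i :+ con 1ℚ :* j) :* x :+ con ½ :* (i :+ con (ℚ.- 1ℚ) :* j) :* y :=
    i :* (con ½ :* (x :+ y)) :+ j :* (con ½ :* (x :+ :- y))) refl i j (w 0F) (w 1F)
  collect i j w 1F = solve 4 (λ i j x y →
    con ½ :* (i :+ con (ℚ.- 1ℚ) :* j) :* x :+ con ½ :* (i :+ con 1ℚ :* j) :* y :=
    i :* (con ½ :* (x :+ y)) :+ j :* (con ½ :* (y :+ :- x))) refl i j (w 0F) (w 1F)

module _ (σ ρ : Permutation′ 4) where

  -- The vectors e_b and f_b are mutually orthogonal with squared norm 2, so the columns (e_b ± f_{σ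
  -- b})/2 and (e_c ± f_{ρ c})/2 meet only where the indices agree.
  gram-combine : ∀ b s c t →
    (permuteDifferences σ ᵀ · permuteDifferences ρ) (pair b s) (pair c t) ≡
    ½ ℚ.* (I b c ℚ.+ ε s t ℚ.* I (σ ⟨$⟩ʳ b) (ρ ⟨$⟩ʳ c))
  gram-combine b s c t = begin
    (permuteDifferences σ ᵀ · permuteDifferences ρ) (pair b s) (pair c t)
      ≡⟨ permuteDifferencesᵀ σ (λ k → permuteDifferences ρ k (pair c t)) b s ⟩
    _ ≡⟨ cong (½ ℚ.*_) (doubleℚ-cong s (λ r → permuteDifferences-combine ρ b r c t)
                                       (λ r → permuteDifferences-combine ρ (σ ⟨$⟩ʳ b) r c t)) ⟩
    _ ≡⟨ cong (½ ℚ.*_) (simplify (I b c) _ (I (σ ⟨$⟩ʳ b) c) _ s t) ⟩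
    ½ ℚ.* (I b c ℚ.+ ε s t ℚ.* I (σ ⟨$⟩ʳ b) (ρ ⟨$⟩ʳ c)) ∎
    where
    simplify : ∀ i j i′ j′ s t →
      doubleℚ s (λ r → ½ ℚ.* (i ℚ.+ ε r t ℚ.* j)) (λ r → ½ ℚ.* (i′ ℚ.+ ε r t ℚ.* j′)) ≡
      i ℚ.+ ε s t ℚ.* j′
    simplify i j i′ j′ 0F 0F = solve 4 (λ i j i′ j′ →
      (con ½ :* (i :+ con 1ℚ :* j) :+ con ½ :* (i :+ con (ℚ.- 1ℚ) :* j)) :+
      (con ½ :* (i′ :+ con 1ℚ :* j′) :+ :- (con ½ :* (i′ :+ con (ℚ.- 1ℚ) :* j′))) :=
      i :+ con 1ℚ :* j′) refl i j i′ j′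
    simplify i j i′ j′ 0F 1F = solve 4 (λ i j i′ j′ →
      (con ½ :* (i :+ con (ℚ.- 1ℚ) :* j) :+ con ½ :* (i :+ con 1ℚ :* j)) :+
      (con ½ :* (i′ :+ con (ℚ.- 1ℚ) :* j′) :+ :- (con ½ :* (i′ :+ con 1ℚ :* j′))) :=
      i :+ con (ℚ.- 1ℚ) :* j′) refl i j i′ j′
    simplify i j i′ j′ 1F 0F = solve 4 (λ i j i′ j′ →
      (con ½ :* (i :+ con 1ℚ :* j) :+ con ½ :* (i :+ con (ℚ.- 1ℚ) :* j)) :+
      (con ½ :* (i′ :+ con (ℚ.- 1ℚ) :* j′) :+ :- (con ½ :* (i′ :+ con 1ℚ :* j′))) :=
      i :+ con (ℚ.- 1ℚ) :* j′) refl i j i′ j′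
    simplify i j i′ j′ 1F 1F = solve 4 (λ i j i′ j′ →
      (con ½ :* (i :+ con (ℚ.- 1ℚ) :* j) :+ con ½ :* (i :+ con 1ℚ :* j)) :+
      (con ½ :* (i′ :+ con 1ℚ :* j′) :+ :- (con ½ :* (i′ :+ con (ℚ.- 1ℚ) :* j′))) :=
      i :+ con 1ℚ :* j′) refl i j i′ j′

I-cong : {i j : Fin m} {k l : Fin n} → (i ≡ j) ⇔ (k ≡ l) → I i j ≡ I k l
I-cong {i = i} {j} {k} {l} eqv = cong (λ x → if x then 1ℚ else 0ℚ) (does-⇔ eqv (i Fin.≟ j) (k Fin.≟ l))

I-sym : (i j : Fin n) → I i j ≡ I j i
I-sym i j = I-cong {i = i} {j} {j} {i} (mk⇔ sym sym)

I-permute : (ρ : Permutation′ n) → ∀ i j → I (ρ ⟨$⟩ʳ i) (ρ ⟨$⟩ʳ j) ≡ I i j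
I-permute ρ i j = I-cong {i = ρ ⟨$⟩ʳ i} {ρ ⟨$⟩ʳ j} {i} {j} (mk⇔
  (λ eq → trans (sym (Perm.inverseˡ ρ)) (trans (cong (ρ ⟨$⟩ˡ_) eq) (Perm.inverseˡ ρ)))
  (cong (ρ ⟨$⟩ʳ_)))

ε-sym : ∀ r s → ε r s ≡ ε s r
ε-sym 0F 0F = refl
ε-sym 0F 1F = refl
ε-sym 1F 0F = refl
ε-sym 1F 1F = refl

-- The transpose of P_ρ is its inverse, P of the inverse permutation. This turns statements about
-- rows and about plain products into statements about columns and `gram-combine`.
permuteDifferences-flip : ∀ ρ → permuteDifferences (Perm.flip ρ) ᵀ ≐ permuteDifferences ρ
permuteDifferences-flip ρ = combine-elim₂ _ λ a r b s → begin
  permuteDifferences (Perm.flip ρ) (pair b s) (pair a r)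
    ≡⟨ permuteDifferences-combine (Perm.flip ρ) b s a r ⟩
  ½ ℚ.* (I b a ℚ.+ ε s r ℚ.* I b (ρ ⟨$⟩ˡ a))
    ≡⟨ cong (½ ℚ.*_) (cong₂ ℚ._+_ (I-sym b a) (cong₂ ℚ._*_ (ε-sym s r) (I-transfer b a))) ⟩
  ½ ℚ.* (I a b ℚ.+ ε r s ℚ.* I a (ρ ⟨$⟩ʳ b))
    ≡⟨ permuteDifferences-combine ρ a r b s ⟨
  permuteDifferences ρ (pair a r) (pair b s) ∎
  where
  I-transfer : ∀ b a → I b (ρ ⟨$⟩ˡ a) ≡ I a (ρ ⟨$⟩ʳ b)
  I-transfer b a = I-cong {i = b} {ρ ⟨$⟩ˡ a} {a} {ρ ⟨$⟩ʳ b} (mk⇔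
    (λ eq → trans (sym (Perm.inverseʳ ρ)) (cong (ρ ⟨$⟩ʳ_) (sym eq)))
    (λ eq → trans (sym (Perm.inverseˡ ρ)) (cong (ρ ⟨$⟩ˡ_) (sym eq))))

permuteDifferences-product : ∀ σ ρ τ → (∀ a → σ ⟨$⟩ʳ (ρ ⟨$⟩ʳ a) ≡ τ ⟨$⟩ʳ a) →
  permuteDifferences σ · permuteDifferences ρ ≐ permuteDifferences τ
permuteDifferences-product σ ρ τ σρ≗τ = combine-elim₂ _ λ a r b s → begin
  (permuteDifferences σ · permuteDifferences ρ) (pair a r) (pair b s)
    ≡⟨ sum-cong-≗ (λ k → cong (ℚ._* permuteDifferences ρ k (pair b s))
         (sym (permuteDifferences-flip σ (pair a r) k))) ⟩
  (permuteDifferences (Perm.flip σ) ᵀ · permuteDifferences ρ) (pair a r) (pair b s)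
    ≡⟨ gram-combine (Perm.flip σ) ρ a r b s ⟩
  ½ ℚ.* (I a b ℚ.+ ε r s ℚ.* I (σ ⟨$⟩ˡ a) (ρ ⟨$⟩ʳ b))
    ≡⟨ cong (λ x → ½ ℚ.* (I a b ℚ.+ ε r s ℚ.* x)) (trans
         (sym (I-permute σ (σ ⟨$⟩ˡ a) (ρ ⟨$⟩ʳ b)))
         (cong₂ I (Perm.inverseʳ σ) (σρ≗τ b))) ⟩
  ½ ℚ.* (I a b ℚ.+ ε r s ℚ.* I a (τ ⟨$⟩ʳ b))
    ≡⟨ permuteDifferences-combine τ a r b s ⟨
  permuteDifferences τ (pair a r) (pair b s) ∎

permuteDifferences-regularOrthogonal : ∀ ρ → RegularOrthogonal (permuteDifferences ρ)
permuteDifferences-regularOrthogonal ρ = record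
  { RᵀR≐I    = columnsOrthonormal ρ
  ; RRᵀ≐I    = λ i j → trans
      (sum-cong-≗ λ k → sym (cong₂ ℚ._*_ (permuteDifferences-flip ρ i k) (permuteDifferences-flip ρ j k)))
      (columnsOrthonormal (Perm.flip ρ) i j)
  ; rowSum≡1 = λ i → trans
      (sum-cong-≗ λ k → sym (trans (ℚ.*-identityʳ _) (permuteDifferences-flip ρ i k)))
      (combine-elim (λ i → (permuteDifferences (Perm.flip ρ) ᵀ ·ᵥ λ _ → 1ℚ) i ≡ 1ℚ)
        -- On the all-ones vector the difference term vanishes and the sum term is 2, so the
        -- right-hand side computes to 1.
        (λ a r → permuteDifferencesᵀ (Perm.flip ρ) (λ _ → 1ℚ) a r) i)
  }
  where
  columnsOrthonormal : ∀ ρ → permuteDifferences ρ ᵀ · permuteDifferences ρ ≐ I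
  columnsOrthonormal ρ = combine-elim₂ _ λ a r b s → trans (gram-combine ρ ρ a r b s)
    (trans (cong (λ x → ½ ℚ.* (I a b ℚ.+ ε r s ℚ.* x)) (I-permute ρ a b))
           (pairs a r b s))
    where
    pairs : ∀ a r b s →
            ½ ℚ.* (I a b ℚ.+ ε r s ℚ.* I a b) ≡ I (pair a r) (pair b s)
    pairs = toWitness {a? = all? λ a → all? λ r → all? λ b → all? λ s →
      ½ ℚ.* (I a b ℚ.+ ε r s ℚ.* I a b) ℚ.≟ I (pair a r) (pair b s)} _

-- Level and decomposability of the factors

R₈≐permuteDifferences : R₈-matrix ≐ permuteDifferences rotation
R₈≐permuteDifferences = toWitness {a? = all? λ i → all? λ j →
  R₈-matrix i j ℚ.≟ permuteDifferences rotation i j} _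

-- `fromℤ z` exposes its numerator and its denominator 1 for a variable `z`, whereas `z / 1` is
-- normalised through a gcd that does not compute.
integral-≡ : ∀ z → fromℤ z ≡ z / 1
integral-≡ z = sym (ℚ.↥p/↧p≡p (fromℤ z))

-- All entries are integral multiples of 1/2, and a moved pair `a` puts 1/2 itself on the diagonal,
-- which excludes level 1.
permuteDifferences-level : ∀ ρ a → ρ ⟨$⟩ʳ a ≢ a → LevelAtMost 2 (permuteDifferences ρ)
permuteDifferences-level ρ a ρa≢a = 2 , record
  { positive = s≤s z≤n
  ; integral = combine-elim₂ _ λ a r b s →
      let z , eq = twice (does (a Fin.≟ b)) (does (r Fin.≟ s)) (does (a Fin.≟ ρ ⟨$⟩ʳ b))
      in z , trans (cong (((+ 2) / 1) ℚ.*_) (permuteDifferences-combine ρ a r b s))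
                   (trans eq (integral-≡ z))
  ; smallest = smallest
  } , s≤s (s≤s z≤n)
  where
  twice : ∀ x e y → ∃[ z ] ((+ 2) / 1) ℚ.* (½ ℚ.* ((if x then 1ℚ else 0ℚ) ℚ.+
          (if e then 1ℚ else ℚ.- 1ℚ) ℚ.* (if y then 1ℚ else 0ℚ))) ≡ fromℤ z
  twice false false false = _ , refl
  twice false false true  = _ , refl
  twice false true  false = _ , refl
  twice false true  true  = _ , refl
  twice true  false false = _ , refl
  twice true  false true  = _ , refl
  twice true  true  false = _ , refl
  twice true  true  true  = _ , refl

  half : permuteDifferences ρ (pair a 0F) (pair a 0F) ≡ ½
  half = trans (permuteDifferences-combine ρ a 0F a 0F)
    (cong₂ (λ x y → ½ ℚ.* ((if x then 1ℚ else 0ℚ) ℚ.+ 1ℚ ℚ.* (if y then 1ℚ else 0ℚ)))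
      (dec-true (a Fin.≟ a) refl) (dec-false (a Fin.≟ ρ ⟨$⟩ʳ a) (ρa≢a ∘ sym)))

  smallest : ∀ k → 1 ≤ k → IntegralMultiple k (permuteDifferences ρ) → 2 ≤ k
  smallest 1             _ int with z , eq ← int (pair a 0F) (pair a 0F) =
    contradiction (cong ↧_ (trans (cong (((+ 1) / 1) ℚ.*_) (sym half)) (trans eq (sym (integral-≡ z))))) λ ()
  smallest (suc (suc k)) _ _   = s≤s (s≤s z≤n)

splitsAt? : (σ : Permutation′ n) (k : ℕ) (M : Matrix n n) → Dec (∀ i j → toℕ i < k → k ≤ toℕ j →
  M (σ ⟨$⟩ʳ i) (σ ⟨$⟩ʳ j) ≡ 0ℚ × M (σ ⟨$⟩ʳ j) (σ ⟨$⟩ʳ i) ≡ 0ℚ)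
splitsAt? σ k M = all? λ i → all? λ j → (toℕ i ℕ.<? k) →-dec (k ℕ.≤? toℕ j) →-dec
  (M (σ ⟨$⟩ʳ i) (σ ⟨$⟩ʳ j) ℚ.≟ 0ℚ ×-dec M (σ ⟨$⟩ʳ j) (σ ⟨$⟩ʳ i) ℚ.≟ 0ℚ)

transposePairs : (c d : Fin 4) → Permutation′ 8
transposePairs c d = transpose (pair c 0F) (pair d 0F) ∘ₚ transpose (pair c 1F) (pair d 1F)

record Factor (ρ : Permutation′ 4) : Set where
  field
    level≤2    : LevelAtMost 2 (permuteDifferences ρ)
    decomposes : Decomposable (permuteDifferences ρ)

-- Here `a` is a pair moved by `ρ`. Exchanging the pairs `c` and `d` brings a `ρ`-invariant set of
-- pairs to the front, and `k` counts its coordinates; with `c` equal to `d` the order is left as it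
-- is.
factor : ∀ ρ a → ρ ⟨$⟩ʳ a ≢ a → ∀ c d k {_ : True (0 ℕ.<? k)} {_ : True (k ℕ.<? 8)}
         {_ : True (splitsAt? (transposePairs c d) k (permuteDifferences ρ))} → Factor ρ
factor ρ a ρa≢a c d k {0<k} {k<8} {splits} = record
  { level≤2    = permuteDifferences-level ρ a ρa≢a
  ; decomposes = transposePairs c d , transposePairs c d , k ,
                 toWitness 0<k , toWitness k<8 , toWitness splits
  }

-- `_∘ₚ_` applies its left argument first, so this is τ⁻¹π.
cofactor : Permutation′ 4 → Permutation′ 4
cofactor τ = rotation ∘ₚ Perm.flip τ

abstract
  -- Each transposition fixes a pair, which is split off. For an adjacent transposition the cofactor
  -- is a 3-cycle and again fixes a pair; for (1 3) it is (0 3)(1 2), so the pairs 0 and 3 form a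
  -- part with 4 coordinates.
  candidates-factor : All (λ τ → Factor τ × Factor (cofactor τ)) candidates
  candidates-factor =
      ( factor (transpose 0F 1F) 0F (λ ()) 0F 2F 2
      , factor (cofactor (transpose 0F 1F)) 1F (λ ()) 0F 0F 2 )
    ∷ ( factor (transpose 1F 2F) 1F (λ ()) 0F 0F 2
      , factor (cofactor (transpose 1F 2F)) 0F (λ ()) 0F 1F 2 )
    ∷ ( factor (transpose 2F 3F) 2F (λ ()) 0F 0F 2
      , factor (cofactor (transpose 2F 3F)) 0F (λ ()) 0F 2F 2 )
    ∷ ( factor (transpose 3F 0F) 0F (λ ()) 0F 1F 2
      , factor (cofactor (transpose 3F 0F)) 0F (λ ()) 0F 3F 2 )
    ∷ ( factor (transpose 1F 3F) 1F (λ ()) 0F 0F 2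
      , factor (cofactor (transpose 1F 3F)) 0F (λ ()) 1F 3F 4 )
    ∷ []

-- From rational matrices to integer blocks

fromℤ-+ : ∀ w z → fromℤ (w ℤ.+ z) ≡ fromℤ w ℚ.+ fromℤ z
fromℤ-+ w z = trans (integral-≡ (w ℤ.+ z))
  (cong (_/ 1) (sym (cong₂ ℤ._+_ (ℤ.*-identityʳ w) (ℤ.*-identityʳ z))))

fromℤ-neg : ∀ z → fromℤ (ℤ.- z) ≡ ℚ.- fromℤ z
fromℤ-neg (+ zero)  = refl
fromℤ-neg (+ suc n) = refl
fromℤ-neg -[1+ n ]  = refl

doubleℚ-fromℤ : ∀ s x y → doubleℚ s (fromℤ ∘ x) (fromℤ ∘ y) ≡ fromℤ (double s x y)
doubleℚ-fromℤ s x y = sym (trans (fromℤ-+ (x 0F ℤ.+ x 1F) (y s ℤ.- y (other s))) (cong₂ ℚ._+_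
  (fromℤ-+ (x 0F) (x 1F))
  (trans (fromℤ-+ (y s) (ℤ.- y (other s))) (cong (fromℤ (y s) ℚ.+_) (fromℤ-neg (y (other s)))))))

doubleℚ-half : ∀ s x y → doubleℚ s (λ r → ½ ℚ.* x r) (λ r → ½ ℚ.* y r) ≡ ½ ℚ.* doubleℚ s x y
doubleℚ-half s x y = solve 4 (λ x₀ x₁ y₀ y₁ →
  (con ½ :* x₀ :+ con ½ :* x₁) :+ (con ½ :* y₀ :+ :- (con ½ :* y₁)) :=
  con ½ :* ((x₀ :+ x₁) :+ (y₀ :+ :- y₁))) refl (x 0F) (x 1F) (y s) (y (other s))

half-cancel : ∀ x {y} → ½ ℚ.* x ≡ y → x ≡ ((+ 2) / 1) ℚ.* y
half-cancel x refl = solve 1 (λ x → x := con ((+ 2) / 1) :* (con ½ :* x)) refl x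

half-01 : ∀ {z} → Is01 (½ ℚ.* fromℤ z) → 0or (+ 2) z
half-01 {z} (inj₁ eq) = inj₁ (cong ↥_ (half-cancel (fromℤ z) eq))
half-01 {z} (inj₂ eq) = inj₂ (cong ↥_ (half-cancel (fromℤ z) eq))

01-half : ∀ {z} → 0or (+ 2) z → Is01 (½ ℚ.* fromℤ z)
01-half (inj₁ refl) = inj₁ refl
01-half (inj₂ refl) = inj₂ refl

quarter-cancel : ∀ x {y} → ½ ℚ.* (½ ℚ.* x) ≡ y → x ≡ ((+ 2) / 1) ℚ.* (((+ 2) / 1) ℚ.* y)
quarter-cancel x eq = half-cancel x (half-cancel (½ ℚ.* x) eq)

quarter-0 : ∀ {z} → ½ ℚ.* (½ ℚ.* fromℤ z) ≡ 0ℚ → z ≡ 0ℤ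
quarter-0 {z} eq = cong ↥_ (quarter-cancel (fromℤ z) eq)

quarter-01 : ∀ {z} → Is01 (½ ℚ.* (½ ℚ.* fromℤ z)) → 0or (+ 4) z
quarter-01 {z} (inj₁ eq) = inj₁ (quarter-0 eq)
quarter-01 {z} (inj₂ eq) = inj₂ (cong ↥_ (quarter-cancel (fromℤ z) eq))

01-quarter : ∀ {z} → 0or (+ 4) z → Is01 (½ ℚ.* (½ ℚ.* fromℤ z))
01-quarter (inj₁ refl) = inj₁ refl
01-quarter (inj₂ refl) = inj₂ refl

bit : ∀ {x} → Is01 x → Fin 2
bit (inj₁ _) = 0F
bit (inj₂ _) = 1F

bit-value : ∀ {x} (p : Is01 x) → x ≡ fromℤ (+ toℕ (bit p))
bit-value (inj₁ x≡0) = x≡0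
bit-value (inj₂ x≡1) = x≡1

-- Since 0 and 1 differ, the bit depends only on the entry and not on the proof from which it is
-- read.
bit-cong : ∀ {x y} (p : Is01 x) (q : Is01 y) → x ≡ y → bit p ≡ bit q
bit-cong (inj₁ _)    (inj₁ _)   _    = refl
bit-cong (inj₁ refl) (inj₂ y≡1) refl = contradiction y≡1 λ ()
bit-cong (inj₂ refl) (inj₁ y≡0) refl = contradiction y≡0 λ ()
bit-cong (inj₂ _)    (inj₂ _)   _    = refl

module _ (B : Matrix 8 8) (G : Fin 4 → Fin 4 → Block)
         (B≗G : ∀ a r b s → B (pair a r) (pair b s) ≡ fromℤ (⟦ G a b ⟧ r s)) where

  -- Each of the two applications of the transpose contributes one factor 1/2; what remains is the
  -- integer computation `switch`.
  conjugate-switch : ∀ ρ a r b s →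
    (permuteDifferences ρ ᵀ · B · permuteDifferences ρ) (pair a r) (pair b s) ≡
    ½ ℚ.* (½ ℚ.* fromℤ (switch ρ G a b r s))
  conjugate-switch ρ a r b s = begin
    (P ᵀ · B · P) (pair a r) (pair b s)
      ≡⟨ conjugate-entry P B (pair a r) (pair b s) ⟩
    (P ᵀ ·ᵥ λ k → (P ᵀ ·ᵥ λ l → B l k) (pair a r)) (pair b s)
      ≡⟨ permuteDifferencesᵀ ρ (λ k → (P ᵀ ·ᵥ λ l → B l k) (pair a r)) b s ⟩
    ½ ℚ.* doubleℚ s (λ q → (P ᵀ ·ᵥ λ l → B l (pair b q)) (pair a r))
                    (λ q → (P ᵀ ·ᵥ λ l → B l (pair (ρ ⟨$⟩ʳ b) q)) (pair a r))
      ≡⟨ cong (½ ℚ.*_) (doubleℚ-cong s (column b) (column (ρ ⟨$⟩ʳ b))) ⟩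
    ½ ℚ.* doubleℚ s (λ q → ½ ℚ.* fromℤ (mixed b q)) (λ q → ½ ℚ.* fromℤ (mixed (ρ ⟨$⟩ʳ b) q))
      ≡⟨ cong (½ ℚ.*_) (trans (doubleℚ-half s (fromℤ ∘ mixed b) (fromℤ ∘ mixed (ρ ⟨$⟩ʳ b)))
           (cong (½ ℚ.*_) (doubleℚ-fromℤ s (mixed b) (mixed (ρ ⟨$⟩ʳ b))))) ⟩
    ½ ℚ.* (½ ℚ.* fromℤ (switch ρ G a b r s)) ∎
    where
    P = permuteDifferences ρ

    mixed : Fin 4 → Fin 2 → ℤ
    mixed c q = double r (λ p → ⟦ G a c ⟧ p q) (λ p → ⟦ G (ρ ⟨$⟩ʳ a) c ⟧ p q)

    column : ∀ c q → (P ᵀ ·ᵥ λ l → B l (pair c q)) (pair a r) ≡ ½ ℚ.* fromℤ (mixed c q)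
    column c q = trans (permuteDifferencesᵀ ρ (λ l → B l (pair c q)) a r) (cong (½ ℚ.*_)
      (trans (doubleℚ-cong r (λ p → B≗G a p c q) (λ p → B≗G (ρ ⟨$⟩ʳ a) p c q))
             (doubleℚ-fromℤ r (λ p → ⟦ G a c ⟧ p q) (λ p → ⟦ G (ρ ⟨$⟩ʳ a) c ⟧ p q))))

  conjugate⇒switchable : ∀ ρ →
    Adjacency (permuteDifferences ρ ᵀ · B · permuteDifferences ρ) → Switchable G ρ
  conjugate⇒switchable ρ adj = record
    { hollow = λ a r → quarter-0 (trans (sym (conjugate-switch ρ a r a r)) (zeroDiagonal (pair a r)))
    ; binary = λ a b r s → quarter-01
        (subst Is01 (conjugate-switch ρ a r b s) (entries01 (pair a r) (pair b s)))
    }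
    where open Adjacency adj

  switchable⇒conjugate : ∀ {ρ} → Adjacency B → Switchable G ρ →
    Adjacency (permuteDifferences ρ ᵀ · B · permuteDifferences ρ)
  switchable⇒conjugate {ρ} adj switchable = record
    { symmetric    = conjugate-symmetric (permuteDifferences ρ) B (Adjacency.symmetric adj)
    ; entries01    = combine-elim₂ _ λ a r b s →
        subst Is01 (sym (conjugate-switch ρ a r b s)) (01-quarter (binary a b r s))
    ; zeroDiagonal = combine-elim _ λ a r → trans (conjugate-switch ρ a r a r)
        (cong (λ z → ½ ℚ.* (½ ℚ.* fromℤ z)) (hollow a r))
    }
    where open Switchable switchable

module AdjacencyBlocks {B : Matrix 8 8} (adj : Adjacency B) where
  open Adjacency adj

  entryBit : Fin 8 → Fin 8 → Fin 2
  entryBit i j = bit (entries01 i j)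

  blocks : Fin 4 → Fin 4 → Block
  blocks a b = entryBit (pair a 0F) (pair b 0F) ∷ entryBit (pair a 0F) (pair b 1F)
             ∷ entryBit (pair a 1F) (pair b 0F) ∷ entryBit (pair a 1F) (pair b 1F) ∷ []

  blocks-value : ∀ a r b s → B (pair a r) (pair b s) ≡ fromℤ (⟦ blocks a b ⟧ r s)
  blocks-value a 0F b 0F = bit-value (entries01 _ _)
  blocks-value a 0F b 1F = bit-value (entries01 _ _)
  blocks-value a 1F b 0F = bit-value (entries01 _ _)
  blocks-value a 1F b 1F = bit-value (entries01 _ _)

  entryBit-sym : ∀ i j → entryBit i j ≡ entryBit j i
  entryBit-sym i j = bit-cong (entries01 i j) (entries01 j i) (symmetric j i)

  entryBit-diagonal : ∀ i → entryBit i i ≡ 0F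
  entryBit-diagonal i = bit-cong (entries01 i i) (inj₁ refl) (zeroDiagonal i)

  blocks-transposed : ∀ a b → blocks b a ≡ blocks a b ᵗ
  blocks-transposed a b
    rewrite entryBit-sym (pair b 0F) (pair a 0F) | entryBit-sym (pair b 0F) (pair a 1F)
          | entryBit-sym (pair b 1F) (pair a 0F) | entryBit-sym (pair b 1F) (pair a 1F) = refl

  blocks-diagonal : ∀ a → blocks a a ≡ hollowBlock (entryBit (pair a 0F) (pair a 1F))
  blocks-diagonal a
    rewrite entryBit-sym (pair a 1F) (pair a 0F)
          | entryBit-diagonal (pair a 0F) | entryBit-diagonal (pair a 1F) = refl

-- Vectors in `𝓥`

abstract
  -- Modulo 2 the value of `double` is the sum of the parities of the two pairs. If these agree, it
  -- is 0 or 2 for constant pairs and 1 ± 1 for mixed pairs.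
  double-parity : ∀ x₀ x₁ y₀ y₁ →
    let x = λ r → + toℕ (lookup (x₀ ∷ x₁ ∷ []) r)
        y = λ r → + toℕ (lookup (y₀ ∷ y₁ ∷ []) r)
    in ((∀ s → 0or (+ 2) (double s x y)) → differ x₀ x₁ ≡ differ y₀ y₁)
     × (differ x₀ x₁ ≡ differ y₀ y₁ → ∀ s → 0or (+ 2) (double s x y))
  double-parity = toWitness {a? = all? λ x₀ → all? λ x₁ → all? λ y₀ → all? λ y₁ →
    let x = λ r → + toℕ (lookup (x₀ ∷ x₁ ∷ []) r)
        y = λ r → + toℕ (lookup (y₀ ∷ y₁ ∷ []) r)
        doubled? = all? λ s → 0or? (+ 2) (double s x y)
        same?    = differ x₀ x₁ Fin.≟ differ y₀ y₁
    in (doubled? →-dec same?) ×-dec (same? →-dec doubled?)} _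

-- Either every pair of v is constant or every pair of v is mixed, and any ρ preserves this.
permuteDifferences-𝓥 : ∀ ρ {v} → v ∈ 𝓥 R₈-matrix → ∀ i → Is01 ((permuteDifferences ρ ᵀ ·ᵥ v) i)
permuteDifferences-𝓥 ρ {v} (v01 , Rᵀv01) = combine-elim _ λ b s →
  subst Is01 (sym (doubled ρ b s))
    (01-half (proj₂ (double-parity (w b 0F) (w b 1F) (w (ρ ⟨$⟩ʳ b) 0F) (w (ρ ⟨$⟩ʳ b) 1F))
      (trans (constant b) (sym (constant (ρ ⟨$⟩ʳ b)))) s))
  where
  w : Fin 4 → Fin 2 → Fin 2
  w b r = bit (v01 (pair b r))

  parity : Fin 4 → Fin 2
  parity b = differ (w b 0F) (w b 1F)

  value : Fin 4 → Fin 2 → ℤ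
  value b r = + toℕ (lookup (w b 0F ∷ w b 1F ∷ []) r)

  value≡ : ∀ b r → v (pair b r) ≡ fromℤ (value b r)
  value≡ b 0F = bit-value (v01 _)
  value≡ b 1F = bit-value (v01 _)

  doubled : ∀ ρ b s → (permuteDifferences ρ ᵀ ·ᵥ v) (pair b s) ≡
                      ½ ℚ.* fromℤ (double s (value b) (value (ρ ⟨$⟩ʳ b)))
  doubled ρ b s = trans (permuteDifferencesᵀ ρ v b s) (cong (½ ℚ.*_)
    (trans (doubleℚ-cong s (value≡ b) (value≡ (ρ ⟨$⟩ʳ b))) (doubleℚ-fromℤ s (value b) (value (ρ ⟨$⟩ʳ b)))))

  step : ∀ b → parity b ≡ parity (rotation ⟨$⟩ʳ b)
  step b = proj₁ (double-parity (w b 0F) (w b 1F) _ _) λ s → half-01 (subst Is01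
    (trans (sum-cong-≗ λ k → cong (ℚ._* v k) (R₈≐permuteDifferences k (pair b s))) (doubled rotation b s))
    (Rᵀv01 (pair b s)))

  constant : ∀ b → parity b ≡ parity 0F
  constant 0F = refl
  constant 1F = sym (step 0F)
  constant 2F = trans (sym (step 1F)) (constant 1F)
  constant 3F = step 3F

-- Assembly of the factorization

theorem21 : (B : Matrix 8 8) → B ∈ 𝓑 (IndecomposableLevel2.matrix R₈) → Reducible R₈ B
theorem21 B (adjB , adjRᵀBR) = record
  { factors             = P ∷ P′ ∷ []
  ; factorsRegular      = permuteDifferences-regularOrthogonal τ
                        ∷ permuteDifferences-regularOrthogonal (cofactor τ) ∷ []
  ; factorsLevel≤2      = Factor.level≤2 factor₁ ∷ Factor.level≤2 factor₂ ∷ []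
  ; factorsDecomposable = Factor.decomposes factor₁ ∷ Factor.decomposes factor₂ ∷ []
  ; factorization       = λ i j → trans (R₈≐permuteDifferences i j) (trans
      (sym (permuteDifferences-product τ (cofactor τ) rotation (λ _ → Perm.inverseʳ τ) i j))
      (sum-cong-≗ λ k → cong (P i k ℚ.*_) (sym (·-identityʳ P′ k j))))
  ; partialSwitchings   = λ
      -- With two factors the only partial product is the first one; as a product of a one-element
      -- list it carries a trailing `I`.
      { 1             _ _             V W V∈𝓥 adjA →
          Adjacency-resp-≐ (conjugate-cong (block B V (V ᵀ) W) λ i j → sym (·-identityʳ (extend _ P) i j))
            (extend-conjugate-adjacency P B V W
              (switchable⇒conjugate B blocks blocks-value {τ} adjB switchable)
              (λ j → permuteDifferences-𝓥 τ (V∈𝓥 j)) adjA)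
      ; (suc (suc _)) _ (s≤s (s≤s ()))
      }
  }
  where
  open AdjacencyBlocks adjB

  switchings : Any (Switchable blocks) candidates
  switchings = candidate-switchable blocks _ blocks-transposed blocks-diagonal
    (conjugate⇒switchable B blocks blocks-value rotation
      (Adjacency-resp-≐ (conjugate-cong B R₈≐permuteDifferences) adjRᵀBR))

  τ : Permutation′ 4
  τ = Any.lookup switchings

  P P′ : Matrix 8 8
  P  = permuteDifferences τ
  P′ = permuteDifferences (cofactor τ)

  found : (Factor τ × Factor (cofactor τ)) × Switchable blocks τ
  -- The decomposability of both factors is read off at the very candidate that the search returned.
  found = All.lookupAny candidates-factor switchings

  factor₁ : Factor τ
  factor₁ = proj₁ (proj₁ found)

  factor₂ : Factor (cofactor τ)
  factor₂ = proj₂ (proj₁ found)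

  switchable : Switchable blocks τ
  switchable = proj₂ found
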